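{- For every DBI normal formula $\varphi$, the pointed action model $(\mathcal{U}_\varphi,0)$ is idempotent: for every pointed Kripke model $(\mathcal{M},w)$, the pointed updates $\bigl(\mathcal{M}\odot\mathcal{U}_\varphi,(w,0)\bigr)$ and $\bigl((\mathcal{M}\odot\mathcal{U}_\varphi)\odot\mathcal{U}_\varphi,((w,0),0)\bigr)$ are both defined and are isomorphic as pointed Kripke models.
   Context: Agents $\mathcal{A}=\{1,\dots,n\}$, $n>1$; language $\mathcal{L}$: $\varphi ::= p \mid \neg\varphi \mid (\varphi\wedge\varphi)\mid B_i\varphi$, $\top$ the usual tautology. Kripke model $\mathcal{M}=\langle S,R,V\rangle$ (nonempty $S$, $R_i\subseteq S\times S$, $V:\mathit{Prop}\to 2^S$), standard truth. Action model $\mathcal{U}=\langle E,Q,\mathsf{pre}\rangle$ (nonempty $E$, $Q_i\subseteq E\times E$, $\mathsf{pre}:E\to\mathcal{L}$). Pointed update of $(\mathcal{M},w)$ with $(\mathcal{U},\alpha)$, defined iff $\mathcal{M},w\vDash\mathsf{pre}(\alpha)$: with $T=\{(x,\beta)\in S\times E\mid\mathcal{M},x\vDash\mathsf{pre}(\beta)\}$, $\mathcal{M}\odot\mathcal{U}=\langle S^{\mathcal U},R^{\mathcal U},V^{\mathcal U}\rangle$ where $S^{\mathcal U}$ is the smallest subset of $T$ containing $(w,\alpha)$ closed under: $(x,\beta)\in S^{\mathcal U}$, $(u,\gamma)\in T$, $xR_iu$, $\beta Q_i\gamma$ imply $(u,\gamma)\in S^{\mathcal U}$; $R^{\mathcal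 U}_i$ relates $(x,\beta),(u,\gamma)\in S^{\mathcal U}$ iff $xR_iu$ and $\beta Q_i\gamma$; $V^{\mathcal U}(p)=\{(x,\beta)\in S^{\mathcal U}\mid x\in V(p)\}$; the result is the pointed model $(\mathcal{M}\odot\mathcal{U},(w,\alpha))$. Two pointed Kripke models are isomorphic if there is a bijection of worlds preserving the relations, the valuation and the point. Target agents: $\mathsf{ta}(p)=\varnothing$, $\mathsf{ta}(\neg\phi)=\mathsf{ta}(\phi)$, $\mathsf{ta}(\phi\wedge\psi)=\mathsf{ta}(\phi)\cup\mathsf{ta}(\psi)$, $\mathsf{ta}(B_i\phi)=\{i\}$. DBI formulas: $\varphi ::= B_i\xi \mid B_i(\xi\wedge\varphi)\mid(\varphi\wedge\varphi)\mid B_i\varphi$, $\xi$ purely propositional. DBI normal: $B_i\xi$ always; $B_i\varphi$, $B_i(\xi\wedge\varphi)$ iff $\varphi$ DBI normal and $i\notin\mathsf{ta}(\varphi)$; $\varphi\wedge\psi$ iff both DBI normal and $\mathsf{ta}(\varphi)\cap\mathsf{ta}(\psi)=\varnothing$. Action model $\mathcal{U}_\varphi=\langle E^\varphi,Q^\varphi,\mathsf{pre}^\varphi\rangle$ for DBI normal $\varphi$, recursively; always $E^\varphi=\{0,-1\}\sqcup D^\varphi$, $\varnothing\ne D^\varphi\subseteq\{1,2,\dots\}$, $\mathsf{pre}^\varphi(0)=\mathsf{pre}^\varphi(-1)=\top$; $\underline{Q}_j:=Q_j\cap((E\setminus\{0\})\times(E\setminus\{0\}))$. (1) $\varphi=B_i\xi$: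 $D=\{m\}$, $\mathsf{pre}(m)=\xi$, $Q_j=\{(0,-1),(m,-1),(-1,-1)\}$ ($j\ne i$), $Q_i=\{(0,m),(m,m),(-1,-1)\}$. (2) $\varphi=B_i\psi$: fresh $m\ge1$, $m\notin D^\psi$; $D^\varphi=D^\psi\sqcup\{m\}$; $\mathsf{pre}^\varphi$ extends $\mathsf{pre}^\psi$ with $\mathsf{pre}^\varphi(m)=\top$; $Q^\varphi_j=\underline{Q}^\psi_j\cup\{(0,-1)\}\cup\{(m,k)\mid(0,k)\in Q^\psi_j\}$ ($j\ne i$); $Q^\varphi_i=\underline{Q}^\psi_i\cup\{(0,m),(m,m)\}$. (3) $\varphi=B_i(\xi\wedge\psi)$: as (2) but $\mathsf{pre}^\varphi(m)=\xi$. (4) $\varphi=\psi\wedge\theta$: with $D^\psi\cap D^\theta=\varnothing$, $D^\varphi=D^\psi\sqcup D^\theta$, $\mathsf{pre}^\varphi=\mathsf{pre}^\psi\cup\mathsf{pre}^\theta$, $Q^\varphi_j=\underline{Q}^\psi_j\cup\underline{Q}^\theta_j\cup\{(0,k)\mid(0,k)\in Q^\psi_j\cup Q^\theta_j, k\in D^\psi\sqcup D^\theta\}\cup\{(0,-1)\mid\text{no such }k\text{ exists}\}$. -}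

module Defs where

open import Data.Bool.Base using (if_then_else_)
open import Data.Fin.Base using (Fin)
open import Data.Fin.Subset using (Subset; ⁅_⁆; _∪_; _∩_) renaming (⊥ to ∅; _∉_ to _∉ˢ_)
open import Data.Integer.Base using (ℤ; +_; 0ℤ; -1ℤ)
open import Data.Integer.Properties using (_≟_)
open import Data.Irrelevant using ([_])
open import Data.List.Base using (List; []; _∷_; _++_)
open import Data.List.Membership.Propositional using (_∈_; _∉_)
open import Data.List.Membership.DecPropositional _≟_ using (_∈?_)
open import Data.List.Relation.Binary.Disjoint.Propositional using (Disjoint)
open import Data.List.Relation.Unary.All as All using (All; []; _∷_)
open import Data.List.Relation.Unary.All.Properties using (++⁺)
open import Data.List.Relation.Unary.Any using (here)
open import Data.Nat.Base using (ℕ; suc) renaming (_≤_ to _≤ₙ_; _<_ to _<ₙ_)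
open import Data.Nat.Properties using (≤-refl; ≤-trans; <-irrefl; m≤n⇒m≤1+n)
open import Data.Product.Base using (Σ-syntax; ∃; _×_; _,_; proj₁; proj₂)
open import Data.Refinement using (Refinement-syntax; value)
open import Data.Sum.Base using (_⊎_)
open import Function.Bundles using (_⤖_; _⇔_; module Bijection)
open import Level using (Level; 0ℓ) renaming (suc to lsuc)
open import Relation.Binary.Core using (Rel)
open import Relation.Binary.PropositionalEquality using (_≡_; _≢_; refl)
open import Relation.Nullary using (¬_; does)
open import Relation.Unary using (Pred)

-- The atom p₀ is only used to write ⊤ in the language.
module Epistemic (n : ℕ) (Atom : Set) (p₀ : Atom) where

  Agent : Set
  Agent = Fin n

  infixr 6 _∧_
  infix  7 ~_

  data Form : Set where
    atom : Atom → Form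
    ~_   : Form → Form
    _∧_  : Form → Form → Form
    B    : Agent → Form → Form

  ⊤ : Form
  ⊤ = ~ (atom p₀ ∧ ~ atom p₀)

  record KripkeModel (ℓ : Level) : Set (lsuc ℓ) where
    field
      World     : Set ℓ
      R         : Agent → Rel World ℓ
      V         : Atom → Pred World ℓ
      .nonempty : World

  open KripkeModel public using (World)

  infix 4 _,_⊨_

  _,_⊨_ : ∀ {ℓ} (M : KripkeModel ℓ) → World M → Form → Set ℓ
  M , w ⊨ atom p  = KripkeModel.V M p w
  M , w ⊨ ~ φ     = ¬ (M , w ⊨ φ)
  M , w ⊨ φ ∧ ψ   = (M , w ⊨ φ) × (M , w ⊨ ψ)
  M , w ⊨ B i φ   = ∀ u → KripkeModel.R M i w u → M , u ⊨ φ

  record ActionModel : Set₁ where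
    field
      Event     : Set
      Q         : Agent → Rel Event 0ℓ
      pre       : Event → Form
      .nonempty : Event

  open ActionModel public using (Event; pre)

  -- Subsets are refinement types: membership proofs are irrelevant, so two
  -- worlds of an update are equal as soon as the underlying pairs are.
  module Update {ℓ} (M : KripkeModel ℓ) (w : World M) (U : ActionModel) (α : Event U)
                (def : M , w ⊨ pre U α) where

    open KripkeModel M using (R; V)
    open ActionModel U using (Q)

    T : Set ℓ
    T = [ xβ ∈ World M × Event U ∣ (M , proj₁ xβ ⊨ pre U (proj₂ xβ)) ]

    Step : Agent → Rel T ℓ
    Step i s t = R i (proj₁ (value s)) (proj₁ (value t)) × Q i (proj₂ (value s)) (proj₂ (value t))

    start : T
    start = record { value = w , α ; proof = [ def ] }

    data Reachable : Pred T ℓ where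
      base : Reachable start
      step : ∀ {s} t i → Reachable s → Step i s t → Reachable t

    point : [ t ∈ T ∣ Reachable t ]
    point = record { value = start ; proof = [ base ] }

    model : KripkeModel ℓ
    model = record
      { World    = [ t ∈ T ∣ Reachable t ]
      ; R        = λ i s t → Step i (value s) (value t)
      ; V        = λ p s → V p (proj₁ (value (value s)))
      ; nonempty = point
      }

  record PointedIso {ℓ} (M : KripkeModel ℓ) (w : World M) (N : KripkeModel ℓ) (v : World N) : Set ℓ where
    private
      module M = KripkeModel M
      module N = KripkeModel N
    field
      bijection : World M ⤖ World N
    open Bijection bijection using (to)
    field
      relations : ∀ i x y → M.R i x y ⇔ N.R i (to x) (to y)
      valuation : ∀ p x → M.V p x ⇔ N.V p (to x)
      points    : to w ≡ v

  Idempotent : (ℓ : Level) (U : ActionModel) → Event U → Set (lsuc ℓ)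
  Idempotent ℓ U α =
    (M : KripkeModel ℓ) (w : World M) →
    Σ[ def₁ ∈ (M , w ⊨ pre U α) ]
      let module M₁ = Update M w U α def₁ in
      Σ[ def₂ ∈ (M₁.model , M₁.point ⊨ pre U α) ]
        let module M₂ = Update M₁.model M₁.point U α def₂ in
        PointedIso M₁.model M₁.point M₂.model M₂.point

  ta : Form → Subset n
  ta (atom p) = ∅
  ta (~ φ)    = ta φ
  ta (φ ∧ ψ)  = ta φ ∪ ta ψ
  ta (B i φ)  = ⁅ i ⁆

  data Propositional : Form → Set where
    atom : ∀ p → Propositional (atom p)
    ~_   : ∀ {ξ} → Propositional ξ → Propositional (~ ξ)
    _∧_  : ∀ {ξ ζ} → Propositional ξ → Propositional ζ → Propositional (ξ ∧ ζ)

  data DBI : Form → Set where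
    Bξ   : ∀ i {ξ} → Propositional ξ → DBI (B i ξ)
    Bξ∧  : ∀ i {ξ ψ} → Propositional ξ → DBI ψ → DBI (B i (ξ ∧ ψ))
    _∧_  : ∀ {ψ θ} → DBI ψ → DBI θ → DBI (ψ ∧ θ)
    Bφ   : ∀ i {ψ} → DBI ψ → DBI (B i ψ)

  data Normal : ∀ {φ} → DBI φ → Set where
    Bξ   : ∀ {i ξ} {x : Propositional ξ} → Normal (Bξ i x)
    Bξ∧  : ∀ {i ξ ψ} {x : Propositional ξ} {d : DBI ψ} → Normal d → i ∉ˢ ta ψ → Normal (Bξ∧ i x d)
    and  : ∀ {ψ θ} {d : DBI ψ} {e : DBI θ} → Normal d → Normal e → ta ψ ∩ ta θ ≡ ∅ → Normal (d ∧ e)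
    Bφ   : ∀ {i ψ} {d : DBI ψ} → Normal d → i ∉ˢ ta ψ → Normal (Bφ i d)

  -- A Labelling records the fresh positive integers m chosen along the
  -- recursive construction of the action model, which is determined by φ only
  -- up to this choice; D is the resulting set of positive events.
  data Labelling : ∀ {φ} → DBI φ → Set
  D : ∀ {φ} {d : DBI φ} → Labelling d → List ℤ

  data Labelling where
    Bξ   : ∀ {i ξ} {x : Propositional ξ} (m : ℕ) → 1 ≤ₙ m → Labelling (Bξ i x)
    Bξ∧  : ∀ {i ξ ψ} {x : Propositional ξ} {d : DBI ψ} (l : Labelling d) (m : ℕ) →
           1 ≤ₙ m → + m ∉ D l → Labelling (Bξ∧ i x d)
    and  : ∀ {ψ θ} {d : DBI ψ} {e : DBI θ} (l : Labelling d) (k : Labelling e) →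
           Disjoint (D l) (D k) → Labelling (d ∧ e)
    Bφ   : ∀ {i ψ} {d : DBI ψ} (l : Labelling d) (m : ℕ) →
           1 ≤ₙ m → + m ∉ D l → Labelling (Bφ i d)

  D (Bξ m _)      = + m ∷ []
  D (Bξ∧ l m _ _) = + m ∷ D l
  D (and l k _)   = D l ++ D k
  D (Bφ l m _ _)  = + m ∷ D l

  E : ∀ {φ} {d : DBI φ} → Labelling d → List ℤ
  E l = 0ℤ ∷ -1ℤ ∷ D l

  -- Extended by the junk value ⊤ to integers outside E l.
  preᴸ : ∀ {φ} {d : DBI φ} → Labelling d → ℤ → Form
  preᴸ (Bξ {ξ = ξ} m _)      e = if does (e ≟ + m) then ξ else ⊤
  preᴸ (Bξ∧ {ξ = ξ} l m _ _) e = if does (e ≟ + m) then ξ else preᴸ l e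
  preᴸ (and l k _)           e = if does (e ∈? D l) then preᴸ l e else preᴸ k e
  preᴸ (Bφ l m _ _)          e = if does (e ≟ + m) then ⊤ else preᴸ l e

  Underline : Rel ℤ 0ℓ → Rel ℤ 0ℓ
  Underline P e f = P e f × e ≢ 0ℤ × f ≢ 0ℤ

  -- The relations for B i ψ and B i (ξ ∧ ψ), from those for ψ.
  QB : Agent → ℤ → (Agent → Rel ℤ 0ℓ) → Agent → Rel ℤ 0ℓ
  QB i m Qψ j e f =
      (j ≢ i × (Underline (Qψ j) e f ⊎ (e , f) ≡ (0ℤ , -1ℤ) ⊎ (e ≡ m × Qψ j 0ℤ f)))
    ⊎ (j ≡ i × (Underline (Qψ j) e f ⊎ (e , f) ∈ (0ℤ , m) ∷ (m , m) ∷ []))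

  Qᴸ : ∀ {φ} {d : DBI φ} → Labelling d → Agent → Rel ℤ 0ℓ
  Qᴸ (Bξ {i = i} m _) j e f =
      (j ≢ i × (e , f) ∈ (0ℤ , -1ℤ) ∷ (+ m , -1ℤ) ∷ (-1ℤ , -1ℤ) ∷ [])
    ⊎ (j ≡ i × (e , f) ∈ (0ℤ , + m) ∷ (+ m , + m) ∷ (-1ℤ , -1ℤ) ∷ [])
  Qᴸ (Bξ∧ {i = i} l m _ _) = QB i (+ m) (Qᴸ l)
  Qᴸ (Bφ {i = i} l m _ _)  = QB i (+ m) (Qᴸ l)
  Qᴸ (and l k _) j e f =
      Underline (Qᴸ l j) e f
    ⊎ Underline (Qᴸ k j) e f
    ⊎ (e ≡ 0ℤ × Succ f)
    ⊎ ((e , f) ≡ (0ℤ , -1ℤ) × ¬ ∃ Succ)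
    where
    Succ : Pred ℤ 0ℓ
    Succ g = (Qᴸ l j 0ℤ g ⊎ Qᴸ k j 0ℤ g) × g ∈ D l ++ D k

  zeroEvent : ∀ {φ} {d : DBI φ} (l : Labelling d) → [ e ∈ ℤ ∣ e ∈ E l ]
  zeroEvent l = record { value = 0ℤ ; proof = [ here refl ] }

  𝓤 : ∀ {φ} {d : DBI φ} → Labelling d → ActionModel
  𝓤 l = record
    { Event    = [ e ∈ ℤ ∣ e ∈ E l ]
    ; Q        = λ j e f → Qᴸ l j (value e) (value f)
    ; pre      = λ e → preᴸ l (value e)
    ; nonempty = zeroEvent l
    }

  -- Fresh choices always exist, so every DBI formula has an action model.
  labelling : ∀ {φ} (d : DBI φ) → Labelling d
  labelling d = proj₁ (from 1 ≤-refl d)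
    where
    Between : ℕ → ℕ → Pred ℤ 0ℓ
    Between a b e = Σ[ m ∈ ℕ ] (e ≡ + m × a ≤ₙ m × m <ₙ b)

    last : ∀ {a b} → a ≤ₙ b → Between a (suc b) (+ b)
    last a≤b = _ , refl , a≤b , ≤-refl

    widen : ∀ {a a′ b b′ xs} → a′ ≤ₙ a → b ≤ₙ b′ → All (Between a b) xs → All (Between a′ b′) xs
    widen p q = All.map λ { (m , e , r , s) → m , e , ≤-trans p r , ≤-trans s q }

    fresh : ∀ {a b xs} → All (Between a b) xs → + b ∉ xs
    fresh ps b∈xs with All.lookup ps b∈xs
    ... | _ , refl , _ , b<b = <-irrefl refl b<b

    apart : ∀ {a b c xs ys} → All (Between a b) xs → All (Between b c) ys → Disjoint xs ys
    apart ps qs (x∈xs , x∈ys) with All.lookup ps x∈xs | All.lookup qs x∈ys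
    ... | _ , refl , _ , m<b | _ , refl , b≤m , _ = <-irrefl refl (≤-trans m<b b≤m)

    from : ∀ {φ} a → 1 ≤ₙ a → (d : DBI φ) →
           Σ[ l ∈ Labelling d ] Σ[ b ∈ ℕ ] (a ≤ₙ b × All (Between a b) (D l))
    from a 1≤a (Bξ i x) = Bξ a 1≤a , suc a , m≤n⇒m≤1+n ≤-refl , last ≤-refl ∷ []
    from a 1≤a (Bξ∧ i x d) with from a 1≤a d
    ... | l , b , a≤b , ps = Bξ∧ l b (≤-trans 1≤a a≤b) (fresh ps) , suc b , m≤n⇒m≤1+n a≤b ,
                             last a≤b ∷ widen ≤-refl (m≤n⇒m≤1+n ≤-refl) ps
    from a 1≤a (Bφ i d) with from a 1≤a d
    ... | l , b , a≤b , ps = Bφ l b (≤-trans 1≤a a≤b) (fresh ps) , suc b , m≤n⇒m≤1+n a≤b ,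
                             last a≤b ∷ widen ≤-refl (m≤n⇒m≤1+n ≤-refl) ps
    from a 1≤a (d ∧ e) with from a 1≤a d
    ... | l , b , a≤b , ps with from b (≤-trans 1≤a a≤b) e
    ... | k , c , b≤c , qs = and l k (apart ps qs) , c , ≤-trans a≤b b≤c ,
                             ++⁺ (widen ≤-refl b≤c ps) (widen a≤b ≤-refl qs)

{-# OPTIONS --safe #-}

-- The preconditions in 𝓤 l are propositional, so a world (x , β) of the update
-- satisfies the same preconditions as x, and (x , β) ↦ ((x , β) , β) is a
-- well-defined embedding of the first update into the second. It is onto because
-- every relation of 𝓤 l is deterministic: from ((w , 0) , 0) both event
-- coordinates can only move in parallel. Normality enters in the conjunction
-- case, where an agent may leave 0 towards a positive event of only one conjunct.
module Submission where

open import Defs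
open import Data.Bool.Base using (true; false)
open import Data.Empty using (⊥; ⊥-elim)
open import Data.Fin.Subset.Properties using (x∈⁅x⁆; x∈p∩q⁺; x∈p∪q⁺; ∉⊥)
import Data.Fin.Subset as Subset
open import Data.Integer.Base using (ℤ; +_; 0ℤ; -1ℤ)
open import Data.Integer.Properties using (_≟_)
open import Data.Irrelevant using ([_])
open import Data.List.Base using ([]; _∷_; _++_)
open import Data.List.Membership.DecPropositional _≟_ using (_∈?_)
open import Data.List.Membership.Propositional using (_∈_; _∉_)
open import Data.List.Membership.Propositional.Properties using (∈-++⁺ˡ; ∈-++⁺ʳ; ∈-++⁻)
open import Data.List.Relation.Binary.Disjoint.Propositional using (Disjoint)
open import Data.List.Relation.Unary.Any using (here; there)
open import Data.Nat.Base using (ℕ; suc; _<_; _≤_)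
open import Data.Product.Base using (_×_; _,_; proj₁; proj₂)
open import Data.Refinement using (Refinement-syntax; value; proof)
open import Data.Sum.Base as Sum using (_⊎_; inj₁; inj₂; [_,_]′)
open import Function.Base using (_∘_; id)
open import Function.Bundles using (mk⤖; mk⇔)
open import Level using (Level; 0ℓ)
open import Relation.Binary.Core using (Rel)
open import Relation.Binary.Definitions using (DecidableEquality)
open import Relation.Binary.PropositionalEquality
  using (_≡_; _≢_; refl; sym; trans; cong; subst)
open import Relation.Nullary using (does; recompute)
open import Relation.Nullary.Decidable using (map′)

value-injective : ∀ {a p} {A : Set a} {P : A → Set p} {x y : [ a ∈ A ∣ P a ]} →
                  value x ≡ value y → x ≡ y
value-injective refl = refl

Deterministic : Rel ℤ 0ℓ → Set
Deterministic P = ∀ {e f g} → P e f → P e g → f ≡ g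

module _ (n : ℕ) (Atom : Set) (p₀ : Atom) where

  open Epistemic n Atom p₀

  -- Truth of propositional formulas.

  ⊨⊤ : ∀ {ℓ} (M : KripkeModel ℓ) w → M , w ⊨ ⊤
  ⊨⊤ M w (p , ¬p) = ¬p p

  ⊤-propositional : Propositional ⊤
  ⊤-propositional = ~ (atom p₀ ∧ ~ atom p₀)

  module _ {ℓ} {M N : KripkeModel ℓ} {v : World M} {w : World N}
           (to   : ∀ p → KripkeModel.V M p v → KripkeModel.V N p w)
           (from : ∀ p → KripkeModel.V N p w → KripkeModel.V M p v) where

    mutual
      -- Negation is contravariant, so the two directions of transfer are proved by mutual
      -- recursion.
      propositional-⊨⁺ : ∀ {ξ} → Propositional ξ → M , v ⊨ ξ → N , w ⊨ ξ
      propositional-⊨⁺ (atom p) h       = to p h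
      propositional-⊨⁺ (~ x)    h       = h ∘ propositional-⊨⁻ x
      propositional-⊨⁺ (x ∧ y)  (h , k) = propositional-⊨⁺ x h , propositional-⊨⁺ y k

      propositional-⊨⁻ : ∀ {ξ} → Propositional ξ → N , w ⊨ ξ → M , v ⊨ ξ
      propositional-⊨⁻ (atom p) h       = from p h
      propositional-⊨⁻ (~ x)    h       = h ∘ propositional-⊨⁺ x
      propositional-⊨⁻ (x ∧ y)  (h , k) = propositional-⊨⁻ x h , propositional-⊨⁻ y k

  -- Idempotence from determinism.

  deterministic⇒idempotent :
    ∀ ℓ (U : ActionModel) (α : Event U) →
    DecidableEquality (Event U) →
    (∀ e → Propositional (pre U e)) →
    (∀ j {e f g} → ActionModel.Q U j e f → ActionModel.Q U j e g → f ≡ g) →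
    pre U α ≡ ⊤ →
    Idempotent ℓ U α
  deterministic⇒idempotent ℓ U α _≟ₑ_ propositional deterministic pre≡⊤ M w =
    def₁ , def₂ , record
      { bijection = mk⤖ {to = diagonal}
          -- The first coordinate `M₂.π` is a left inverse of `diagonal` by computation. That it is
          -- also a right inverse is where determinism is used.
          ((λ eq → cong (proj₁ ∘ value ∘ value) eq) , λ t → M₂.π t , λ { refl → diagonal-π t })
      -- A step of the second update is a step of the first together with an event edge. Between
      -- diagonal worlds this edge is already the second component of the first step.
      ; relations = λ i x y → mk⇔ (λ s → s , proj₂ s) proj₁
      ; valuation = λ p x → mk⇔ id id
      ; points    = refl
      }
    where
    trivially-⊨ : (N : KripkeModel ℓ) (v : World N) → N , v ⊨ pre U α
    trivially-⊨ N v = subst (N , v ⊨_) (sym pre≡⊤) (⊨⊤ N v)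

    def₁ : M , w ⊨ pre U α
    def₁ = trivially-⊨ M w

    module M₁ = Update M w U α def₁

    def₂ : M₁.model , M₁.point ⊨ pre U α
    def₂ = trivially-⊨ M₁.model M₁.point

    module M₂ where
      open Update M₁.model M₁.point U α def₂ public

      π : World model → World M₁.model
      π = proj₁ ∘ value ∘ value

    event₁ : World M₁.model → Event U
    event₁ = proj₂ ∘ value ∘ value

    -- The update copies the valuation of the underlying world, so atoms transfer by the identity.
    pre-preserved : (s : World M₁.model) → M , proj₁ (value (value s)) ⊨ pre U (event₁ s) →
                    M₁.model , s ⊨ pre U (event₁ s)
    pre-preserved s = propositional-⊨⁺ {M = M} {N = M₁.model} (λ _ → id) (λ _ → id)
                        (propositional (event₁ s))

    lift : World M₁.model → M₂.T
    lift s with proof (value s)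
    ... | [ h ] = record { value = s , event₁ s ; proof = [ pre-preserved s h ] }

    -- A path of the first update is replayed in the second, each event edge being used for both
    -- event coordinates.
    lift-reachable : ∀ {t} (r : M₁.Reachable t) →
                     M₂.Reachable (lift (record { value = t ; proof = [ r ] }))
    lift-reachable M₁.base           = M₂.base
    lift-reachable (M₁.step t i r s) = M₂.step _ i (lift-reachable r) (s , proj₂ s)

    diagonal : World M₁.model → World M₂.model
    diagonal s with proof s
    ... | [ r ] = record { value = lift s ; proof = [ lift-reachable r ] }

    -- Both event coordinates start at `α`. A step moves them by the same agent, and by induction
    -- from the same event, so determinism makes the targets equal.
    events-agree : ∀ {t} → M₂.Reachable t → event₁ (proj₁ (value t)) ≡ proj₂ (value t)
    events-agree M₂.base = refl
    events-agree (M₂.step t i r ((_ , q₁) , q₂)) =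
      deterministic i (subst (λ e → ActionModel.Q U i e _) (events-agree r) q₁) q₂

    diagonal-π : ∀ t → diagonal (M₂.π t) ≡ t
    diagonal-π t with proof t
    ... | [ r ] = value-injective (value-injective (cong (M₂.π t ,_)
                    -- Reachability is available only irrelevantly, so the equality drawn from it is
                    -- recomputed by deciding equality of events.
                    (recompute (event₁ (M₂.π t) ≟ₑ proj₂ (value (value t))) (events-agree r))))

  -- Event labels and preconditions.

  +-pos≢0 : ∀ {m} → 1 ≤ m → + m ≢ 0ℤ
  +-pos≢0 () refl

  D≢0 : ∀ {φ} {d : DBI φ} (l : Labelling d) {e} → e ∈ D l → e ≢ 0ℤ
  D≢0 (Bξ m 1≤m)      (here refl) = +-pos≢0 1≤m
  D≢0 (Bξ∧ l m 1≤m _) (here refl) = +-pos≢0 1≤m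
  D≢0 (Bξ∧ l m _ _)   (there e∈)  = D≢0 l e∈
  D≢0 (Bφ l m 1≤m _)  (here refl) = +-pos≢0 1≤m
  D≢0 (Bφ l m _ _)    (there e∈)  = D≢0 l e∈
  D≢0 (and l k _)     e∈          = [ D≢0 l , D≢0 k ]′ (∈-++⁻ (D l) e∈)

  D≢-1 : ∀ {φ} {d : DBI φ} (l : Labelling d) {e} → e ∈ D l → e ≢ -1ℤ
  D≢-1 (Bξ m _)      (here refl) = λ ()
  D≢-1 (Bξ∧ l m _ _) (here refl) = λ ()
  D≢-1 (Bξ∧ l m _ _) (there e∈)  = D≢-1 l e∈
  D≢-1 (Bφ l m _ _)  (here refl) = λ ()
  D≢-1 (Bφ l m _ _)  (there e∈)  = D≢-1 l e∈
  D≢-1 (and l k _)   e∈          = [ D≢-1 l , D≢-1 k ]′ (∈-++⁻ (D l) e∈)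

  pre-0 : ∀ {φ} {d : DBI φ} (l : Labelling d) → preᴸ l 0ℤ ≡ ⊤
  -- Exposing the label as a successor lets the test of `0ℤ` against it compute to `false`.
  pre-0 (Bξ (suc m) _)      = refl
  pre-0 (Bξ∧ l (suc m) _ _) = pre-0 l
  pre-0 (Bφ l (suc m) _ _)  = pre-0 l
  -- Both branches reduce to `⊤`, so the outcome of the test is simply abstracted.
  pre-0 (and l k _) with does (0ℤ ∈? D l)
  ... | true  = pre-0 l
  ... | false = pre-0 k

  -- Belief operators are encoded as edges between events. Preconditions receive only the parts `ξ`
  -- and `⊤`.
  pre-propositional : ∀ {φ} {d : DBI φ} (l : Labelling d) e → Propositional (preᴸ l e)
  pre-propositional (Bξ {x = x} m _) e with does (e ≟ + m)
  ... | true  = x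
  ... | false = ⊤-propositional
  pre-propositional (Bξ∧ {x = x} l m _ _) e with does (e ≟ + m)
  ... | true  = x
  ... | false = pre-propositional l e
  pre-propositional (Bφ l m _ _) e with does (e ≟ + m)
  ... | true  = ⊤-propositional
  ... | false = pre-propositional l e
  pre-propositional (and l k _) e with does (e ∈? D l)
  ... | true  = pre-propositional l e
  ... | false = pre-propositional k e

  -- Sources and targets of the event relations.

  E-there : ∀ {x xs} {e : ℤ} → e ∈ 0ℤ ∷ -1ℤ ∷ xs → e ∈ 0ℤ ∷ -1ℤ ∷ x ∷ xs
  E-there (here eq)          = here eq
  E-there (there (here eq))  = there (here eq)
  E-there (there (there e∈)) = there (there (there e∈))

  -- Both recursive belief cases use `QB`, so its properties are proved once, for an arbitrary
  -- family `P` in place of the relations of the subformula.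
  QB-source : ∀ {i m j P xs} → (∀ {e f} → P j e f → e ∈ 0ℤ ∷ -1ℤ ∷ xs) →
              ∀ {e f} → QB i m P j e f → e ∈ 0ℤ ∷ -1ℤ ∷ m ∷ xs
  QB-source src (inj₁ (_ , inj₁ (q , _)))             = E-there (src q)
  QB-source src (inj₁ (_ , inj₂ (inj₁ refl)))         = here refl
  QB-source src (inj₁ (_ , inj₂ (inj₂ (refl , _))))   = there (there (here refl))
  QB-source src (inj₂ (_ , inj₁ (q , _)))             = E-there (src q)
  QB-source src (inj₂ (_ , inj₂ (here refl)))         = here refl
  QB-source src (inj₂ (_ , inj₂ (there (here refl)))) = there (there (here refl))

  -- The relations live on all integers. Confining sources to `E l` turns freshness and disjointness
  -- of labels into the absence of common sources.
  Q-source : ∀ {φ} {d : DBI φ} (l : Labelling d) {j e f} → Qᴸ l j e f → e ∈ E l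
  Q-source (Bξ m _) (inj₁ (_ , here refl))                 = here refl
  Q-source (Bξ m _) (inj₁ (_ , there (here refl)))         = there (there (here refl))
  Q-source (Bξ m _) (inj₁ (_ , there (there (here refl)))) = there (here refl)
  Q-source (Bξ m _) (inj₂ (_ , here refl))                 = here refl
  Q-source (Bξ m _) (inj₂ (_ , there (here refl)))         = there (there (here refl))
  Q-source (Bξ m _) (inj₂ (_ , there (there (here refl)))) = there (here refl)
  Q-source (Bξ∧ l m _ _) q = QB-source {P = Qᴸ l} (Q-source l) q
  Q-source (Bφ l m _ _)  q = QB-source {P = Qᴸ l} (Q-source l) q
  Q-source (and l k _) (inj₁ (q , _)) with Q-source l q
  ... | here eq          = here eq
  ... | there (here eq)  = there (here eq)
  ... | there (there e∈) = there (there (∈-++⁺ˡ e∈))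
  Q-source (and l k _) (inj₂ (inj₁ (q , _))) with Q-source k q
  ... | here eq          = here eq
  ... | there (here eq)  = there (here eq)
  ... | there (there e∈) = there (there (∈-++⁺ʳ (D l) e∈))
  Q-source (and l k _) (inj₂ (inj₂ (inj₁ (refl , _)))) = here refl
  Q-source (and l k _) (inj₂ (inj₂ (inj₂ (refl , _)))) = here refl

  QB-from--1 : ∀ {i m j P} → (∀ {f} → P j -1ℤ f → f ≡ -1ℤ) →
               ∀ {f} → QB i (+ m) P j -1ℤ f → f ≡ -1ℤ
  QB-from--1 ih (inj₁ (_ , inj₁ (q , _)))           = ih q
  QB-from--1 ih (inj₁ (_ , inj₂ (inj₁ ())))
  QB-from--1 ih (inj₁ (_ , inj₂ (inj₂ (() , _))))
  QB-from--1 ih (inj₂ (_ , inj₁ (q , _)))           = ih q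
  QB-from--1 ih (inj₂ (_ , inj₂ (here ())))
  QB-from--1 ih (inj₂ (_ , inj₂ (there (here ()))))

  -- Apart from `0ℤ`, the event `-1ℤ` is the only one shared by two conjuncts. As it can only lead
  -- to itself, their relations cannot conflict there.
  Q-from--1 : ∀ {φ} {d : DBI φ} (l : Labelling d) {j f} → Qᴸ l j -1ℤ f → f ≡ -1ℤ
  Q-from--1 (Bξ m _) (inj₁ (_ , there (there (here refl)))) = refl
  Q-from--1 (Bξ m _) (inj₂ (_ , there (there (here refl)))) = refl
  Q-from--1 (Bξ∧ l m _ _) q = QB-from--1 {P = Qᴸ l} (Q-from--1 l) q
  Q-from--1 (Bφ l m _ _)  q = QB-from--1 {P = Qᴸ l} (Q-from--1 l) q
  Q-from--1 (and l k _) (inj₁ (q , _))        = Q-from--1 l q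
  Q-from--1 (and l k _) (inj₂ (inj₁ (q , _))) = Q-from--1 k q
  Q-from--1 (and l k _) (inj₂ (inj₂ (inj₁ (() , _))))
  Q-from--1 (and l k _) (inj₂ (inj₂ (inj₂ (() , _))))

  QB-from-0 : ∀ {i m j P f} → 1 ≤ m → f ≢ -1ℤ → QB i (+ m) P j 0ℤ f → j Subset.∈ Subset.⁅ i ⁆
  QB-from-0 _   f≢-1 (inj₁ (_ , inj₁ (_ , 0≢0 , _)))     = ⊥-elim (0≢0 refl)
  QB-from-0 _   f≢-1 (inj₁ (_ , inj₂ (inj₁ refl)))       = ⊥-elim (f≢-1 refl)
  QB-from-0 1≤m f≢-1 (inj₁ (_ , inj₂ (inj₂ (0≡m , _))))  = ⊥-elim (+-pos≢0 1≤m (sym 0≡m))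
  QB-from-0 _   f≢-1 (inj₂ (refl , _))                   = x∈⁅x⁆ _

  -- The construction sends every agent outside `ta φ` from `0ℤ` to `-1ℤ`. This links edges to the
  -- disjointness of target agents.
  Q-from-0 : ∀ {φ} {d : DBI φ} (l : Labelling d) {j f} → f ≢ -1ℤ → Qᴸ l j 0ℤ f → j Subset.∈ ta φ
  Q-from-0 (Bξ m _) f≢-1 (inj₁ (_ , here refl))         = ⊥-elim (f≢-1 refl)
  Q-from-0 (Bξ m _) f≢-1 (inj₁ (_ , there (here refl))) = ⊥-elim (f≢-1 refl)
  Q-from-0 (Bξ m _) f≢-1 (inj₁ (_ , there (there (here ()))))
  Q-from-0 (Bξ m _) f≢-1 (inj₂ (refl , _))              = x∈⁅x⁆ _
  Q-from-0 (Bξ∧ l m 1≤m _) f≢-1 q = QB-from-0 {P = Qᴸ l} 1≤m f≢-1 q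
  Q-from-0 (Bφ l m 1≤m _)  f≢-1 q = QB-from-0 {P = Qᴸ l} 1≤m f≢-1 q
  Q-from-0 (and l k _) f≢-1 (inj₁ (_ , 0≢0 , _))        = ⊥-elim (0≢0 refl)
  Q-from-0 (and l k _) f≢-1 (inj₂ (inj₁ (_ , 0≢0 , _))) = ⊥-elim (0≢0 refl)
  Q-from-0 (and l k _) f≢-1 (inj₂ (inj₂ (inj₁ (_ , q , _)))) =
    x∈p∪q⁺ (Sum.map (Q-from-0 l f≢-1) (Q-from-0 k f≢-1) q)
  Q-from-0 (and l k _) f≢-1 (inj₂ (inj₂ (inj₂ (refl , _)))) = ⊥-elim (f≢-1 refl)

  -- Determinism of the event relations.

  QB-deterministic : ∀ {i m j P} → m ≢ 0ℤ → (∀ {f} → P j m f → ⊥) → Deterministic (P j) →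
                     Deterministic (QB i m P j)
  QB-deterministic m≢0 ¬Pm det (inj₁ (j≢i , _)) (inj₂ (j≡i , _)) = ⊥-elim (j≢i j≡i)
  QB-deterministic m≢0 ¬Pm det (inj₂ (j≡i , _)) (inj₁ (j≢i , _)) = ⊥-elim (j≢i j≡i)
  QB-deterministic {m = m} {j} {P} m≢0 ¬Pm det (inj₁ (_ , p)) (inj₁ (_ , q)) = other p q
    where
    -- The three kinds of edges have disjoint sources: `Underline` excludes `0ℤ`, and `m` has no
    -- outgoing edge in `P`. Edges from `m` copy those of `P` from `0ℤ`, so determinism of `P` at
    -- `0ℤ` settles them.
    other : Deterministic (λ e f → Underline (P j) e f ⊎ (e , f) ≡ (0ℤ , -1ℤ) ⊎ (e ≡ m × P j 0ℤ f))
    other (inj₁ (p , _))             (inj₁ (q , _))             = det p q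
    other (inj₁ (_ , e≢0 , _))       (inj₂ (inj₁ refl))         = ⊥-elim (e≢0 refl)
    other (inj₁ (p , _))             (inj₂ (inj₂ (refl , _)))   = ⊥-elim (¬Pm p)
    other (inj₂ (inj₁ refl))         (inj₁ (_ , e≢0 , _))       = ⊥-elim (e≢0 refl)
    other (inj₂ (inj₁ refl))         (inj₂ (inj₁ refl))         = refl
    other (inj₂ (inj₁ refl))         (inj₂ (inj₂ (0≡m , _)))    = ⊥-elim (m≢0 (sym 0≡m))
    other (inj₂ (inj₂ (refl , _)))   (inj₁ (q , _))             = ⊥-elim (¬Pm q)
    other (inj₂ (inj₂ (0≡m , _)))    (inj₂ (inj₁ refl))         = ⊥-elim (m≢0 (sym 0≡m))
    other (inj₂ (inj₂ (_ , p)))      (inj₂ (inj₂ (_ , q)))      = det p q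
  QB-deterministic {m = m} {j} {P} m≢0 ¬Pm det (inj₂ (_ , p)) (inj₂ (_ , q)) = same p q
    where
    -- The added edges all end in `m`, and their sources `0ℤ` and `m` have no underlined edge.
    same : Deterministic (λ e f → Underline (P j) e f ⊎ (e , f) ∈ (0ℤ , m) ∷ (m , m) ∷ [])
    same (inj₁ (p , _))              (inj₁ (q , _))              = det p q
    same (inj₁ (_ , e≢0 , _))        (inj₂ (here refl))          = ⊥-elim (e≢0 refl)
    same (inj₁ (p , _))              (inj₂ (there (here refl)))  = ⊥-elim (¬Pm p)
    same (inj₂ (here refl))          (inj₁ (_ , e≢0 , _))        = ⊥-elim (e≢0 refl)
    same (inj₂ (there (here refl)))  (inj₁ (q , _))              = ⊥-elim (¬Pm q)
    same (inj₂ (here refl))          (inj₂ (here refl))          = refl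
    same (inj₂ (here refl))          (inj₂ (there (here refl)))  = refl
    same (inj₂ (there (here refl)))  (inj₂ (here refl))          = refl
    same (inj₂ (there (here refl)))  (inj₂ (there (here refl)))  = refl

  fresh-no-source : ∀ {φ} {d : DBI φ} (l : Labelling d) {m j f} → 1 ≤ m → + m ∉ D l →
                    Qᴸ l j (+ m) f → ⊥
  fresh-no-source l 1≤m m∉ q with Q-source l q
  ... | here m≡0         = +-pos≢0 1≤m m≡0
  ... | there (there m∈) = m∉ m∈

  -- A common source is not `0ℤ`, and by disjointness not positive. It is therefore `-1ℤ`, where
  -- both relations stay.
  Underline-agree : ∀ {φ χ} {d : DBI φ} {c : DBI χ} (l : Labelling d) (k : Labelling c) →
                    Disjoint (D l) (D k) → ∀ {j e f g} →
                    Underline (Qᴸ l j) e f → Underline (Qᴸ k j) e g → f ≡ g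
  Underline-agree l k dis (p , e≢0 , _) (q , _) with Q-source l p | Q-source k q
  ... | here e≡0          | _                 = ⊥-elim (e≢0 e≡0)
  ... | _                 | here e≡0          = ⊥-elim (e≢0 e≡0)
  ... | there (here refl) | _                 = trans (Q-from--1 l p) (sym (Q-from--1 k q))
  ... | _                 | there (here refl) = trans (Q-from--1 l p) (sym (Q-from--1 k q))
  ... | there (there e∈l) | there (there e∈k) = ⊥-elim (dis (e∈l , e∈k))

  Q-deterministic : ∀ {φ} {d : DBI φ} → Normal d → (l : Labelling d) →
                    ∀ j → Deterministic (Qᴸ l j)
  Q-deterministic _ (Bξ m _) j (inj₁ (j≢i , _)) (inj₂ (j≡i , _)) = ⊥-elim (j≢i j≡i)
  Q-deterministic _ (Bξ m _) j (inj₂ (j≡i , _)) (inj₁ (j≢i , _)) = ⊥-elim (j≢i j≡i)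
  Q-deterministic _ (Bξ m _) j (inj₁ (_ , p)) (inj₁ (_ , q)) = trans (target p) (sym (target q))
    where
    target : ∀ {e f : ℤ} → (e , f) ∈ (0ℤ , -1ℤ) ∷ (+ m , -1ℤ) ∷ (-1ℤ , -1ℤ) ∷ [] → f ≡ -1ℤ
    target (here refl)                 = refl
    target (there (here refl))         = refl
    target (there (there (here refl))) = refl
  Q-deterministic _ (Bξ m _) j (inj₂ (_ , p)) (inj₂ (_ , q)) = same p q
    where
    same : Deterministic (λ e f → (e , f) ∈ (0ℤ , + m) ∷ (+ m , + m) ∷ (-1ℤ , -1ℤ) ∷ [])
    same (here refl)                 (here refl)                 = refl
    same (here refl)                 (there (here refl))         = refl
    same (there (here refl))         (here refl)                 = refl
    same (there (here refl))         (there (here refl))         = refl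
    same (here refl)                 (there (there (here ())))
    same (there (here refl))         (there (there (here ())))
    same (there (there (here refl))) (there (there (here refl))) = refl
  Q-deterministic (Bξ∧ ν _) (Bξ∧ l m 1≤m m∉) j =
    QB-deterministic {P = Qᴸ l} (+-pos≢0 1≤m) (fresh-no-source l 1≤m m∉) (Q-deterministic ν l j)
  Q-deterministic (Bφ ν _) (Bφ l m 1≤m m∉) j =
    QB-deterministic {P = Qᴸ l} (+-pos≢0 1≤m) (fresh-no-source l 1≤m m∉) (Q-deterministic ν l j)
  Q-deterministic (and {ψ} {θ} ν μ ta∩ta≡∅) (and l k dis) j = both
    where
    -- This is the use of normality: the agent `j` cannot be a target agent of both conjuncts.
    not-both : j Subset.∈ ta ψ → j Subset.∈ ta θ → ⊥
    not-both j∈ψ j∈θ = ∉⊥ (subst (j Subset.∈_) ta∩ta≡∅ (x∈p∩q⁺ (j∈ψ , j∈θ)))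

    ≢-1 : ∀ {e} → e ∈ D l ++ D k → e ≢ -1ℤ
    ≢-1 e∈ = [ D≢-1 l , D≢-1 k ]′ (∈-++⁻ (D l) e∈)

    -- Both targets are positive, so edges from different conjuncts would put `j` in both sets of
    -- target agents. Edges from the same conjunct agree by induction.
    from-0 : ∀ {f g} → f ∈ D l ++ D k → g ∈ D l ++ D k →
             Qᴸ l j 0ℤ f ⊎ Qᴸ k j 0ℤ f → Qᴸ l j 0ℤ g ⊎ Qᴸ k j 0ℤ g → f ≡ g
    from-0 _  _  (inj₁ p) (inj₁ q) = Q-deterministic ν l j p q
    from-0 f∈ g∈ (inj₁ p) (inj₂ q) =
      ⊥-elim (not-both (Q-from-0 l (≢-1 f∈) p) (Q-from-0 k (≢-1 g∈) q))
    from-0 f∈ g∈ (inj₂ p) (inj₁ q) =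
      ⊥-elim (not-both (Q-from-0 l (≢-1 g∈) q) (Q-from-0 k (≢-1 f∈) p))
    from-0 _  _  (inj₂ p) (inj₂ q) = Q-deterministic μ k j p q

    both : Deterministic (Qᴸ (and l k dis) j)
    both (inj₁ (p , _))        (inj₁ (q , _))        = Q-deterministic ν l j p q
    both (inj₁ p)              (inj₂ (inj₁ q))       = Underline-agree l k dis p q
    both (inj₂ (inj₁ p))       (inj₁ q)              = sym (Underline-agree l k dis q p)
    both (inj₂ (inj₁ (p , _))) (inj₂ (inj₁ (q , _))) = Q-deterministic μ k j p q
    -- Underlined edges never leave `0ℤ`, while the other two kinds leave only `0ℤ`.
    both (inj₁ (_ , e≢0 , _))        (inj₂ (inj₂ (inj₁ (e≡0 , _))))  = ⊥-elim (e≢0 e≡0)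
    both (inj₁ (_ , e≢0 , _))        (inj₂ (inj₂ (inj₂ (refl , _)))) = ⊥-elim (e≢0 refl)
    both (inj₂ (inj₁ (_ , e≢0 , _))) (inj₂ (inj₂ (inj₁ (e≡0 , _))))  = ⊥-elim (e≢0 e≡0)
    both (inj₂ (inj₁ (_ , e≢0 , _))) (inj₂ (inj₂ (inj₂ (refl , _)))) = ⊥-elim (e≢0 refl)
    both (inj₂ (inj₂ (inj₁ (e≡0 , _))))  (inj₁ (_ , e≢0 , _))        = ⊥-elim (e≢0 e≡0)
    both (inj₂ (inj₂ (inj₂ (refl , _)))) (inj₁ (_ , e≢0 , _))        = ⊥-elim (e≢0 refl)
    both (inj₂ (inj₂ (inj₁ (e≡0 , _))))  (inj₂ (inj₁ (_ , e≢0 , _))) = ⊥-elim (e≢0 e≡0)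
    both (inj₂ (inj₂ (inj₂ (refl , _)))) (inj₂ (inj₁ (_ , e≢0 , _))) = ⊥-elim (e≢0 refl)
    both (inj₂ (inj₂ (inj₁ (_ , p , f∈)))) (inj₂ (inj₂ (inj₁ (_ , q , g∈)))) = from-0 f∈ g∈ p q
    -- The default edge to `-1ℤ` requires that no positive successor exists, which `s` contradicts.
    both (inj₂ (inj₂ (inj₁ (_ , s))))      (inj₂ (inj₂ (inj₂ (_ , ¬s))))     = ⊥-elim (¬s (_ , s))
    both (inj₂ (inj₂ (inj₂ (_ , ¬s))))     (inj₂ (inj₂ (inj₁ (_ , s))))      = ⊥-elim (¬s (_ , s))
    both (inj₂ (inj₂ (inj₂ (refl , _))))   (inj₂ (inj₂ (inj₂ (refl , _))))   = refl

theorem7 : (ℓ : Level) (n : ℕ) → 1 < n → (Atom : Set) (p₀ : Atom) →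
    let open Epistemic n Atom p₀ in
    (φ : Form) (d : DBI φ) → Normal d → (l : Labelling d) →
    Idempotent ℓ (𝓤 l) (zeroEvent l)
theorem7 ℓ n _ Atom p₀ φ d ν l =
  deterministic⇒idempotent n Atom p₀ ℓ (𝓤 l) (zeroEvent l)
    (λ e f → map′ value-injective (cong value) (value e ≟ value f))
    (λ e → pre-propositional n Atom p₀ l (value e))
    (λ j p q → value-injective (Q-deterministic n Atom p₀ ν l j p q))
    (pre-0 n Atom p₀ l)
  where open Epistemic n Atom p₀
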